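{- Let $m\ge 2$ and $n\ge 3$ be coprime integers. Let $a,b$ be the smallest possible positive integers such that $an-bm=1$, and let $\alpha,\beta$ be the smallest possible positive integers such that $\alpha m-\beta n=1$. Let $k\in\mathbb{N}$. If $a>\beta$, then $$\sum_{k_1+k_2=k}\frac{\tilde\beta_{k_1}(m)}{k_1!}\frac{\tilde\beta_{k_2}(n)}{k_2!}= n\sum_{k_1+k_2=k}\ \sum_{s_1+s_2=k_1}\frac{(-bm)_{s_1}}{s_1!}\frac{\tilde\sigma_{s_2}(n,a-1)}{s_2!}\frac{\tilde\beta_{k_2}(m)}{k_2!}-m\sum_{k_1+k_2=k}\ \sum_{s_1+s_2=k_1}\frac{(-bm)_{s_1}}{s_1!}\frac{\tilde\sigma_{s_2}(m,b-1)}{s_2!}\frac{\tilde\beta_{k_2}(n)}{k_2!}.$$ If $a<\beta$, then $$\sum_{k_1+k_2=k}\frac{\tilde\beta_{k_1}(m)}{k_1!}\frac{\tilde\beta_{k_2}(n)}{k_2!}= m\sum_{k_1+k_2=k}\ \sum_{s_1+s_2=k_1}\frac{(-\beta n)_{s_1}}{s_1!}\frac{\tilde\sigma_{s_2}(m,\alpha-1)}{s_2!}\frac{\tilde\beta_{k_2}(n)}{k_2!}-n\sum_{k_1+k_2=k}\ \sum_{s_1+s_2=k_1}\frac{(-\beta n)_{s_1}}{s_1!}\frac{\tilde\sigma_{s_2}(n,\beta-1)}{s_2!}\frac{\tilde\beta_{k_2}(m)}{k_2!}.$$ All sums run over pairs of nonnegative integers.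
   Context: The degenerate Bernoulli numbers $\beta_k(\lambda)$ ($\lambda\neq 0$) are defined by $\frac{t}{(1+\lambda t)^{1/\lambda}-1}=\sum_{k\ge 0}\beta_k(\lambda)\frac{t^k}{k!}$, and for a positive integer $m$ one sets $\tilde\beta_k(m)=m^k\beta_k(1/m)$; equivalently $\frac{m}{\Psi_m(x)}=\sum_{k\ge 0}\frac{(-1)^k}{k!}\tilde\beta_k(m)(1-x)^k$ with $\Psi_m(x)=\sum_{j=0}^{m-1}x^j$. For a real number $r$, $(r)_k=r(r-1)\cdots(r-k+1)$ is the falling factorial (with $(r)_0=1$). For integers $\lambda\ge 1$ and $c\ge 0$, $\tilde\sigma_k(\lambda,c)=\sum_{i=0}^{c}(\lambda i)_k$. -}

module Defs where

open import Data.Fin.Base using (Fin; zero; suc; toℕ)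
open import Data.Integer.Base as ℤ using (ℤ; +_)
open import Data.Nat.Base as ℕ using (ℕ; zero; suc; _∸_; _!)
open import Data.Nat.Properties using (_!≢0)
open import Data.Product.Base using (_×_)
open import Data.Rational.Base
import Data.Rational.Unnormalised.Base as ℚᵘ
import Data.Rational.Unnormalised.Properties as ℚᵘ
open import Data.Rational.Properties
open import Data.Rational.Solver using (module +-*-Solver)
open import Data.Vec.Functional using (Vector; _∷_)
open import Relation.Binary.PropositionalEquality

open import Algebra.Definitions.RawSemiring +-*-rawSemiring public using (sum; _^_)
open import Algebra.Properties.CommutativeMonoid.Sum +-0-commutativeMonoid
  using (sum-cong-≗)

fromℤ : ℤ → ℚ
fromℤ i = i / 1

fromℕ : ℕ → ℚ
fromℕ n = fromℤ (+ n)

infixl 7 _/!_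

_/!_ : ℚ → ℕ → ℚ
q /! k = q * (+ 1 / k !) {{k !≢0}}

sumPairs : ℕ → (ℕ → ℕ → ℚ) → ℚ
sumPairs k f = sum {suc k} (λ i → f (toℕ i) (k ∸ toℕ i))

infix 5 sumPairs

syntax sumPairs k (λ i j → e) = ∑[ i + j ≡ k ] e

falling : ℚ → ℕ → ℚ
falling r zero    = 1ℚ
falling r (suc k) = falling r k * (r - fromℕ k)

------------------------------------------------------------------------
-- Formal power series over ℚ, as coefficient sequences

_⊛_ : (ℕ → ℚ) → (ℕ → ℚ) → ℕ → ℚ
(f ⊛ g) k = ∑[ i + j ≡ k ] f i * g j

one : ℕ → ℚ
one zero    = 1ℚ
one (suc _) = 0ℚ

t : ℕ → ℚ
t (suc zero) = 1ℚ
t _          = 0ℚ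

-- The coefficients q (k - 1), …, q 0 of f / g, newest first, for a series g
-- with constant term 1: q k = f k - ∑_{i < k} g (i + 1) q (k - 1 - i).

quotientPrefix : (f g : ℕ → ℚ) (k : ℕ) → Vector ℚ k
quotientCoeff  : (f g : ℕ → ℚ) (k : ℕ) → ℚ

quotientPrefix f g (suc k) zero    = quotientCoeff f g k
quotientPrefix f g (suc k) (suc i) = quotientPrefix f g k i

quotientCoeff f g k = f k - sum (λ i → g (suc (toℕ i)) * quotientPrefix f g k i)

-- (1 + l t)^(1/l), as the binomial series ∑ (1/l)_k (l t)^k / k!.

binomialSeries : (l : ℚ) .{{_ : NonZero l}} → ℕ → ℚ
binomialSeries l k = falling (1/ l) k * l ^ k /! k

-- The degenerate Bernoulli numbers β_k(l): the series (1 + l t)^(1/l) - 1 is t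
-- times a series with constant term 1, so t is cancelled before dividing.
-- See degenerateBernoulli-generating below.

degenerateBernoulli : (k : ℕ) (l : ℚ) .{{_ : NonZero l}} → ℚ
degenerateBernoulli k l =
  fromℕ (k !) * quotientCoeff one (λ j → binomialSeries l (suc j)) k

β̃ : (k m : ℕ) .{{_ : ℕ.NonZero m}} → ℚ
β̃ k m = fromℕ m ^ k * degenerateBernoulli k (+ 1 / m) {{1/m≢0}}
  where
  1/m≢0 : NonZero (+ 1 / m)
  1/m≢0 = pos⇒nonZero (+ 1 / m) {{normalize-pos 1 m}}

σ̃ : (k l c : ℕ) → ℚ
σ̃ k l c = sum {suc c} (λ i → falling (fromℕ (l ℕ.* toℕ i)) k)

-- The pair (x , y) consists of the smallest positive integers
-- satisfying x p - y q = 1.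

IsSmallestSolution : (p q x y : ℕ) → Set
IsSmallestSolution p q x y =
  Solution x y × (∀ x′ y′ → Solution x′ y′ → x ℕ.≤ x′ × y ℕ.≤ y′)
  where
  Solution : ℕ → ℕ → Set
  Solution u v =
    0 ℕ.< u × 0 ℕ.< v × + u ℤ.* + p ℤ.- + v ℤ.* + q ≡ + 1

------------------------------------------------------------------------
-- The generating function of the degenerate Bernoulli numbers

private
  open +-*-Solver using (solve; _:=_; _:+_; _:*_; _:-_; con)

  quotientPrefix-coeff : ∀ f g k (i : Fin (suc k)) →
    quotientPrefix f g (suc k) i ≡ quotientCoeff f g (k ∸ toℕ i)
  quotientPrefix-coeff f g k       zero    = refl
  quotientPrefix-coeff f g (suc k) (suc i) = quotientPrefix-coeff f g k i

  cancel : ∀ x y → 1ℚ * (x - y) + y ≡ x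
  cancel = solve 2 (λ x y → con 1ℚ :* (x :- y) :+ y := x) refl

  ⊛-quotient : ∀ f g → g 0 ≡ 1ℚ → ∀ k → (g ⊛ quotientCoeff f g) k ≡ f k
  ⊛-quotient f g g₀ zero = begin
    g 0 * (f 0 - 0ℚ) + 0ℚ   ≡⟨ cong (λ x → x * (f 0 - 0ℚ) + 0ℚ) g₀ ⟩
    1ℚ * (f 0 - 0ℚ) + 0ℚ    ≡⟨ cancel (f 0) 0ℚ ⟩
    f 0                     ∎
    where open ≡-Reasoning
  ⊛-quotient f g g₀ (suc k) = begin
    g 0 * (f (suc k) - s) + sum u   ≡⟨ cong₂ (λ x y → x * (f (suc k) - s) + y) g₀ u≡s ⟩
    1ℚ * (f (suc k) - s) + s        ≡⟨ cancel (f (suc k)) s ⟩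
    f (suc k)                       ∎
    where
    open ≡-Reasoning
    u : Vector ℚ (suc k)
    u i = g (suc (toℕ i)) * quotientCoeff f g (k ∸ toℕ i)
    s : ℚ
    s = sum (λ i → g (suc (toℕ i)) * quotientPrefix f g (suc k) i)
    u≡s : sum u ≡ s
    u≡s = sum-cong-≗ λ i →
      cong (g (suc (toℕ i)) *_) (sym (quotientPrefix-coeff f g k i))

  fromℕ-cancel : ∀ n .{{_ : ℕ.NonZero n}} → fromℕ n * (+ 1 / n) ≡ 1ℚ
  fromℕ-cancel n@(suc d) = toℚᵘ-injective (begin
    toℚᵘ (fromℕ n * (+ 1 / n))           ≈⟨ toℚᵘ-homo-* (fromℕ n) (+ 1 / n) ⟩
    toℚᵘ (fromℕ n) ℚᵘ.* toℚᵘ (+ 1 / n)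
      ≈⟨ ℚᵘ.*-cong (toℚᵘ-fromℚᵘ (ℚᵘ.mkℚᵘ (+ n) 0)) (toℚᵘ-fromℚᵘ (ℚᵘ.mkℚᵘ (+ 1) d)) ⟩
    ℚᵘ.mkℚᵘ (+ n) 0 ℚᵘ.* ℚᵘ.mkℚᵘ (+ 1) d
      ≈⟨ ℚᵘ.*≡* (S.solve 1 (λ x → x S.:* S.con (+ 1) S.:* S.con (+ 1)
                          S.:= S.con (+ 1) S.:* (S.con (+ 1) S.:* x)) refl (+ n)) ⟩
    toℚᵘ 1ℚ                              ∎)
    where
    open import Relation.Binary.Reasoning.Setoid ℚᵘ.≃-setoid
    import Data.Integer.Solver
    module S = Data.Integer.Solver.+-*-Solver

  !-cancel : ∀ k x → (fromℕ (k !) * x) /! k ≡ x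
  !-cancel k x = begin
    fromℕ (k !) * x * r     ≡⟨ solve 3 (λ a b c → a :* b :* c := a :* c :* b) refl (fromℕ (k !)) x r ⟩
    fromℕ (k !) * r * x     ≡⟨ cong (_* x) (fromℕ-cancel (k !) {{k !≢0}}) ⟩
    1ℚ * x                  ≡⟨ *-identityˡ x ⟩
    x                       ∎
    where
    open ≡-Reasoning
    r = (+ 1 / k !) {{k !≢0}}

  binomialSeries-1 : ∀ l .{{_ : NonZero l}} → binomialSeries l 1 ≡ 1ℚ
  binomialSeries-1 l = begin
    1ℚ * (1/ l - 0ℚ) * (l * 1ℚ) * 1ℚ
      ≡⟨ solve 2 (λ x y → con 1ℚ :* (x :- con 0ℚ) :* (y :* con 1ℚ) :* con 1ℚ := x :* y) refl (1/ l) l ⟩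
    1/ l * l    ≡⟨ *-inverseˡ l ⟩
    1ℚ          ∎
    where open ≡-Reasoning

-- ((1 + l t)^(1/l) - 1) · ∑ β_k(l) t^k / k! = t

degenerateBernoulli-generating : ∀ l .{{_ : NonZero l}} k →
  ((λ i → binomialSeries l i - one i) ⊛ (λ j → degenerateBernoulli j l /! j)) k ≡ t k
degenerateBernoulli-generating l zero = begin
  0ℚ * b + 0ℚ   ≡⟨ solve 1 (λ x → con 0ℚ :* x :+ con 0ℚ := con 0ℚ) refl b ⟩
  0ℚ            ∎
  where
  open ≡-Reasoning
  b = degenerateBernoulli 0 l /! 0
degenerateBernoulli-generating l (suc k) = begin
  0ℚ * b + sum u           ≡⟨ solve 2 (λ x y → con 0ℚ :* x :+ y := y) refl b (sum u) ⟩
  sum u                    ≡⟨ sum-cong-≗ u≗v ⟩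
  (g ⊛ quotientCoeff one g) k   ≡⟨ ⊛-quotient one g (binomialSeries-1 l) k ⟩
  one k                    ≡⟨ one≡t k ⟩
  t (suc k)                ∎
  where
  open ≡-Reasoning
  g : ℕ → ℚ
  g j = binomialSeries l (suc j)
  b : ℚ
  b = degenerateBernoulli (suc k) l /! suc k
  u : Vector ℚ (suc k)
  u i = (g (toℕ i) - 0ℚ) * (degenerateBernoulli (k ∸ toℕ i) l /! (k ∸ toℕ i))
  u≗v : ∀ i → u i ≡ g (toℕ i) * quotientCoeff one g (k ∸ toℕ i)
  u≗v i = cong₂ _*_
    (solve 1 (λ x → x :- con 0ℚ := x) refl (g (toℕ i)))
    (!-cancel (k ∸ toℕ i) (quotientCoeff one g (k ∸ toℕ i)))
  one≡t : ∀ j → one j ≡ t (suc j)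
  one≡t zero    = refl
  one≡t (suc _) = refl

{-# OPTIONS --safe #-}

-- Write (1 + t)^r for the series ∑ (r)_k t^k / k!, and B_m = ∑ β̃_k(m) t^k / k!, so that
-- ((1 + t)^m - 1) B_m = m t.  If a n - b m = 1, the geometric sums
-- S = ∑_{i<a} (1 + t)^(n i) and T = ∑_{i<b} (1 + t)^(m i) satisfy
--   (1 + t)^(- b m) (S ((1 + t)^n - 1) - T ((1 + t)^m - 1)) = (1 + t) - 1 = t.
-- Multiplying by B_m B_n and cancelling t gives
--   (1 + t)^(- b m) (n S B_m - m T B_n) = B_m B_n,
-- whose coefficients are the first formula.  The second one is the same identity with the
-- roles of m and n exchanged.

module Submission where

open import Defs
open import Algebra.Bundles using (CommutativeRing; CommutativeSemiring)
import Algebra.Construct.Pointwise as Pointwise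
import Algebra.Properties.Group as Group
import Algebra.Properties.Semiring.Sum as Sum
import Algebra.Solver.Ring.NaturalCoefficients.Default as SemiringSolver
open import Algebra.Structures.Biased using (isCommutativeSemiringˡ; isCommutativeMonoidˡ)
open import Data.Fin.Base using (toℕ)
open import Data.Integer.Base as ℤ using (ℤ; +_)
import Data.Integer.Properties as ℤ
import Data.Integer.Solver as ℤSolver
open import Data.Nat.Base as ℕ using (ℕ; zero; suc; _≤_; _<_; _>_; _∸_; _!)
import Data.Nat.Properties as ℕ
open import Data.Nat.Coprimality using (Coprime)
open import Data.Product.Base using (_×_; _,_)
open import Data.Rational.Base using (ℚ; NonZero; 0ℚ; 1ℚ; _+_; _*_; _-_; _/_; 1/_; fromℚᵘ)
open import Data.Rational.Properties
  using (toℚᵘ-injective; toℚᵘ-fromℚᵘ; toℚᵘ-homo-+; toℚᵘ-homo-*; fromℚᵘ-cong;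
         pos⇒nonZero; normalize-pos; *-inverseʳ; *-identityˡ; *-identityʳ; *-zeroˡ; *-zeroʳ;
         +-identityˡ; +-identityʳ; *-comm; *-assoc;
         +-*-commutativeRing; +-0-group)
open import Data.Rational.Solver using (module +-*-Solver)
open import Data.Rational.Unnormalised.Base as ℚᵘ using (mkℚᵘ)
import Data.Rational.Unnormalised.Properties as ℚᵘ
open import Function.Base using (_∘_)
open import Relation.Binary.PropositionalEquality
  using (_≡_; _≗_; refl; sym; trans; cong; cong₂; isEquivalence; module ≡-Reasoning)
import Relation.Binary.Reasoning.Setoid as SetoidReasoning

open CommutativeRing +-*-commutativeRing using (semiring; +-isCommutativeMonoid)
open Sum semiring using (*-distribˡ-sum; *-distribʳ-sum; sum-cong-≗)

private
  module ℚ-Solver = +-*-Solver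

-- The embedding of the integers into ℚ

fromℚᵘ-homo-+ : ∀ p q → fromℚᵘ (p ℚᵘ.+ q) ≡ fromℚᵘ p + fromℚᵘ q
fromℚᵘ-homo-+ p q = toℚᵘ-injective
  (ℚᵘ.≃-trans (toℚᵘ-fromℚᵘ (p ℚᵘ.+ q))
  (ℚᵘ.≃-trans (ℚᵘ.+-cong (ℚᵘ.≃-sym (toℚᵘ-fromℚᵘ p)) (ℚᵘ.≃-sym (toℚᵘ-fromℚᵘ q)))
              (ℚᵘ.≃-sym (toℚᵘ-homo-+ (fromℚᵘ p) (fromℚᵘ q)))))

fromℚᵘ-homo-* : ∀ p q → fromℚᵘ (p ℚᵘ.* q) ≡ fromℚᵘ p * fromℚᵘ q
fromℚᵘ-homo-* p q = toℚᵘ-injective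
  (ℚᵘ.≃-trans (toℚᵘ-fromℚᵘ (p ℚᵘ.* q))
  (ℚᵘ.≃-trans (ℚᵘ.*-cong (ℚᵘ.≃-sym (toℚᵘ-fromℚᵘ p)) (ℚᵘ.≃-sym (toℚᵘ-fromℚᵘ q)))
              (ℚᵘ.≃-sym (toℚᵘ-homo-* (fromℚᵘ p) (fromℚᵘ q)))))

-- `fromℤ i` unfolds to `fromℚᵘ (mkℚᵘ i 0)`, so the claim is checked on unnormalised fractions,
-- where equality is cross multiplication in ℤ.
fromℤ-homo-+ : ∀ i j → fromℤ (i ℤ.+ j) ≡ fromℤ i + fromℤ j
fromℤ-homo-+ i j = trans
  (fromℚᵘ-cong {mkℚᵘ (i ℤ.+ j) 0} {mkℚᵘ i 0 ℚᵘ.+ mkℚᵘ j 0} (ℚᵘ.*≡* (solve 2 (λ x y →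
    (x :+ y) :* con (+ 1) := (x :* con (+ 1) :+ y :* con (+ 1)) :* con (+ 1)) refl i j)))
  (fromℚᵘ-homo-+ (mkℚᵘ i 0) (mkℚᵘ j 0))
  where open ℤSolver.+-*-Solver

fromℤ-homo-* : ∀ i j → fromℤ (i ℤ.* j) ≡ fromℤ i * fromℤ j
fromℤ-homo-* i j = fromℚᵘ-homo-* (mkℚᵘ i 0) (mkℚᵘ j 0)

fromℕ-homo-+ : ∀ m n → fromℕ (m ℕ.+ n) ≡ fromℕ m + fromℕ n
fromℕ-homo-+ m n = fromℤ-homo-+ (+ m) (+ n)

fromℕ-homo-* : ∀ m n → fromℕ (m ℕ.* n) ≡ fromℕ m * fromℕ n
fromℕ-homo-* m n = trans (cong fromℤ (ℤ.pos-* m n)) (fromℤ-homo-* (+ m) (+ n))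

fromℕ-inverseʳ : ∀ n .{{_ : ℕ.NonZero n}} → fromℕ n * (+ 1 / n) ≡ 1ℚ
fromℕ-inverseʳ (suc d) = trans
  (sym (fromℚᵘ-homo-* (mkℚᵘ (+ suc d) 0) (mkℚᵘ (+ 1) d)))
  (fromℚᵘ-cong {mkℚᵘ (+ suc d) 0 ℚᵘ.* mkℚᵘ (+ 1) d} {mkℚᵘ (+ 1) 0} (ℚᵘ.*≡* (solve 1 (λ x →
    x :* con (+ 1) :* con (+ 1) := con (+ 1) :* (con (+ 1) :* x)) refl (+ suc d))))
  where open ℤSolver.+-*-Solver

1/-unique : ∀ p q .{{_ : NonZero q}} → p * q ≡ 1ℚ → 1/ q ≡ p
1/-unique p q pq≡1 = begin
  1/ q              ≡⟨ *-identityˡ (1/ q) ⟨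
  1ℚ * 1/ q         ≡⟨ cong (_* 1/ q) pq≡1 ⟨
  p * q * 1/ q      ≡⟨ *-assoc p q (1/ q) ⟩
  p * (q * 1/ q)    ≡⟨ cong (p *_) (*-inverseʳ q) ⟩
  p * 1ℚ            ≡⟨ *-identityʳ p ⟩
  p                 ∎
  where open ≡-Reasoning

-- The semiring of formal power series

Series : Set
Series = ℕ → ℚ

infixl 6 _⊕_
infixl 7 _·_

_⊕_ : Series → Series → Series
(f ⊕ g) k = f k + g k

0̂ : Series
0̂ _ = 0ℚ

_·_ : ℚ → Series → Series
(c · f) k = c * f k

-- As (f ⊛ g) (suc k) reduces to f 0 * g (suc k) + ((f ∘ suc) ⊛ g) k, identities for ⊛ go by
-- induction on the index with the left factor shifted.

⊛-cong : ∀ {f f′ g g′} → f ≗ f′ → g ≗ g′ → f ⊛ g ≗ f′ ⊛ g′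
⊛-cong p q k = sum-cong-≗ {suc k} λ i → cong₂ _*_ (p (toℕ i)) (q (k ∸ toℕ i))

⊛-distribʳ : ∀ h f g → (f ⊕ g) ⊛ h ≗ (f ⊛ h) ⊕ (g ⊛ h)
⊛-distribʳ h f g zero = solve 3 (λ x y z →
  (x :+ y) :* z :+ con 0ℚ := (x :* z :+ con 0ℚ) :+ (y :* z :+ con 0ℚ)) refl (f 0) (g 0) (h 0)
  where open ℚ-Solver
⊛-distribʳ h f g (suc k) = trans
  (cong (λ x → (f 0 + g 0) * h (suc k) + x) (⊛-distribʳ h (f ∘ suc) (g ∘ suc) k))
  (solve 5 (λ x y z u v →
    (x :+ y) :* z :+ (u :+ v) := (x :* z :+ u) :+ (y :* z :+ v)) refl
    (f 0) (g 0) (h (suc k)) (((f ∘ suc) ⊛ h) k) (((g ∘ suc) ⊛ h) k))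
  where open ℚ-Solver

⊛-scaleˡ : ∀ c f g → (c · f) ⊛ g ≗ c · (f ⊛ g)
⊛-scaleˡ c f g k = trans
  (sum-cong-≗ {suc k} λ i → *-assoc c (f (toℕ i)) (g (k ∸ toℕ i)))
  (sym (*-distribˡ-sum {suc k} c (λ i → f (toℕ i) * g (k ∸ toℕ i))))

⊛-zeroˡ : ∀ f → 0̂ ⊛ f ≗ 0̂
⊛-zeroˡ f zero    = solve 1 (λ x → con 0ℚ :* x :+ con 0ℚ := con 0ℚ) refl (f 0)
  where open ℚ-Solver
⊛-zeroˡ f (suc k) = trans (cong (λ x → 0ℚ * f (suc k) + x) (⊛-zeroˡ f k))
  (solve 1 (λ x → con 0ℚ :* x :+ con 0ℚ := con 0ℚ) refl (f (suc k)))
  where open ℚ-Solver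

⊛-identityˡ : ∀ f → one ⊛ f ≗ f
⊛-identityˡ f zero    = solve 1 (λ x → con 1ℚ :* x :+ con 0ℚ := x) refl (f 0)
  where open ℚ-Solver
⊛-identityˡ f (suc k) = trans (cong (λ x → 1ℚ * f (suc k) + x) (⊛-zeroˡ f k))
  (solve 1 (λ x → con 1ℚ :* x :+ con 0ℚ := x) refl (f (suc k)))
  where open ℚ-Solver

-- Unfolding `⊛` splits off the term with index 0 in the left factor. This is the mirror image for
-- the right factor, which the induction for commutativity needs.
⊛-sucʳ : ∀ f g k → (f ⊛ g) (suc k) ≡ f (suc k) * g 0 + (f ⊛ (g ∘ suc)) k
⊛-sucʳ f g zero = solve 4 (λ a b c d →
  a :* b :+ (c :* d :+ con 0ℚ) := c :* d :+ (a :* b :+ con 0ℚ)) refl (f 0) (g 1) (f 1) (g 0)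
  where open ℚ-Solver
⊛-sucʳ f g (suc k) = trans
  (cong (λ x → f 0 * g (suc (suc k)) + x) (⊛-sucʳ (f ∘ suc) g k))
  (solve 3 (λ x y z → x :+ (y :+ z) := y :+ (x :+ z)) refl
    (f 0 * g (suc (suc k))) (f (suc (suc k)) * g 0) (((f ∘ suc) ⊛ (g ∘ suc)) k))
  where open ℚ-Solver

⊛-comm : ∀ f g → f ⊛ g ≗ g ⊛ f
⊛-comm f g zero    = cong (_+ 0ℚ) (*-comm (f 0) (g 0))
⊛-comm f g (suc k) = begin
  f 0 * g (suc k) + ((f ∘ suc) ⊛ g) k   ≡⟨ cong₂ _+_ (*-comm (f 0) (g (suc k))) (⊛-comm (f ∘ suc) g k) ⟩
  g (suc k) * f 0 + (g ⊛ (f ∘ suc)) k   ≡⟨ ⊛-sucʳ g f k ⟨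
  (g ⊛ f) (suc k)                       ∎
  where open ≡-Reasoning

⊛-assoc : ∀ f g h → (f ⊛ g) ⊛ h ≗ f ⊛ (g ⊛ h)
⊛-assoc f g h zero = solve 3 (λ x y z →
  (x :* y :+ con 0ℚ) :* z :+ con 0ℚ := x :* (y :* z :+ con 0ℚ) :+ con 0ℚ) refl (f 0) (g 0) (h 0)
  where open ℚ-Solver
⊛-assoc f g h (suc k) = begin
  -- The shifted series `(f ⊛ g) ∘ suc` unfolds to `f 0 · (g ∘ suc) ⊕ ((f ∘ suc) ⊛ g)`, so
  -- distributivity reduces the claim to the induction hypothesis for `f ∘ suc`.
  (f 0 * g 0 + 0ℚ) * h (suc k) + ((f 0 · (g ∘ suc) ⊕ ((f ∘ suc) ⊛ g)) ⊛ h) k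
    ≡⟨ cong (λ x → (f 0 * g 0 + 0ℚ) * h (suc k) + x) (trans
         (⊛-distribʳ h (f 0 · (g ∘ suc)) ((f ∘ suc) ⊛ g) k)
         (cong₂ _+_ (⊛-scaleˡ (f 0) (g ∘ suc) h k) (⊛-assoc (f ∘ suc) g h k))) ⟩
  (f 0 * g 0 + 0ℚ) * h (suc k) + (f 0 * ((g ∘ suc) ⊛ h) k + ((f ∘ suc) ⊛ (g ⊛ h)) k)
    ≡⟨ solve 5 (λ x y z u v →
         (x :* y :+ con 0ℚ) :* z :+ (x :* u :+ v) := x :* (y :* z :+ u) :+ v) refl
         (f 0) (g 0) (h (suc k)) (((g ∘ suc) ⊛ h) k) (((f ∘ suc) ⊛ (g ⊛ h)) k) ⟩
  f 0 * (g 0 * h (suc k) + ((g ∘ suc) ⊛ h) k) + ((f ∘ suc) ⊛ (g ⊛ h)) k ∎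
  where
  open ≡-Reasoning
  open ℚ-Solver

-- Series are compared coefficientwise. There is no negation in this structure, so series identities
-- involving a difference are stated with the subtracted term on the other side.
⊕-⊛-commutativeSemiring : CommutativeSemiring _ _
⊕-⊛-commutativeSemiring = record
  { Carrier = Series
  ; _≈_     = _≗_
  ; _+_     = _⊕_
  ; _*_     = _⊛_
  ; 0#      = 0̂
  ; 1#      = one
  ; isCommutativeSemiring = isCommutativeSemiringˡ record
    { +-isCommutativeMonoid = Pointwise.isCommutativeMonoid ℕ +-isCommutativeMonoid
    ; *-isCommutativeMonoid = isCommutativeMonoidˡ record
      { isSemigroup = record
        { isMagma = record
          { isEquivalence = Pointwise.isEquivalence ℕ isEquivalence
          ; ∙-cong        = ⊛-cong
          }
        ; assoc = ⊛-assoc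
        }
      ; identityˡ = ⊛-identityˡ
      ; comm      = ⊛-comm
      }
    ; distribʳ = ⊛-distribʳ
    ; zeroˡ    = ⊛-zeroˡ
    }
  }

module 𝕊 = CommutativeSemiring ⊕-⊛-commutativeSemiring
module 𝕊-Solver = SemiringSolver ⊕-⊛-commutativeSemiring

-- Multiplication by t, scalars, and rescaling of the variable.

t-⊛-suc : ∀ f k → (t ⊛ f) (suc k) ≡ f k
t-⊛-suc f k = begin
  0ℚ * f (suc k) + ((t ∘ suc) ⊛ f) k   ≡⟨ cong (λ x → x + ((t ∘ suc) ⊛ f) k) (*-zeroˡ (f (suc k))) ⟩
  0ℚ + ((t ∘ suc) ⊛ f) k               ≡⟨ +-identityˡ _ ⟩
  ((t ∘ suc) ⊛ f) k                    ≡⟨ ⊛-cong {g = f} t∘suc≗one (λ _ → refl) k ⟩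
  (one ⊛ f) k                          ≡⟨ ⊛-identityˡ f k ⟩
  f k                                  ∎
  where
  open ≡-Reasoning
  t∘suc≗one : t ∘ suc ≗ one
  t∘suc≗one zero    = refl
  t∘suc≗one (suc _) = refl

-- Takes the place of division by t: the coefficients of the product at k + 1 are those of the other
-- factor at k.
t-cancel : ∀ {f g} → t ⊛ f ≗ t ⊛ g → f ≗ g
t-cancel {f} {g} tf≗tg k = trans (sym (t-⊛-suc f k)) (trans (tf≗tg (suc k)) (t-⊛-suc g k))

-- Scalars as elements of the semiring, so that its solver can move them.
constant : ℚ → Series
constant c = c · one

constant-⊛ : ∀ c f → constant c ⊛ f ≗ c · f
constant-⊛ c f k = trans (⊛-scaleˡ c one f k) (cong (c *_) (⊛-identityˡ f k))

-- The series f(c t).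
substitute : ℚ → Series → Series
substitute c f k = c ^ k * f k

substitute-⊛ : ∀ c f g → substitute c f ⊛ substitute c g ≗ substitute c (f ⊛ g)
substitute-⊛ c f g zero = solve 2 (λ x y →
  con 1ℚ :* x :* (con 1ℚ :* y) :+ con 0ℚ := con 1ℚ :* (x :* y :+ con 0ℚ)) refl (f 0) (g 0)
  where open ℚ-Solver
substitute-⊛ c f g (suc k) = begin
  1ℚ * f 0 * (c ^ suc k * g (suc k)) + ((substitute c f ∘ suc) ⊛ substitute c g) k
    ≡⟨ cong (λ x → 1ℚ * f 0 * (c ^ suc k * g (suc k)) + x) (trans
         (⊛-cong {g = substitute c g} (λ j → *-assoc c (c ^ j) (f (suc j))) (λ _ → refl) k)
         (⊛-scaleˡ c (substitute c (f ∘ suc)) (substitute c g) k)) ⟩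
  1ℚ * f 0 * (c ^ suc k * g (suc k)) + c * (substitute c (f ∘ suc) ⊛ substitute c g) k
    ≡⟨ cong (λ x → 1ℚ * f 0 * (c ^ suc k * g (suc k)) + c * x) (substitute-⊛ c (f ∘ suc) g k) ⟩
  1ℚ * f 0 * (c ^ suc k * g (suc k)) + c * (c ^ k * ((f ∘ suc) ⊛ g) k)
    ≡⟨ solve 5 (λ c d x y z →
         con 1ℚ :* x :* (c :* d :* y) :+ c :* (d :* z) := c :* d :* (x :* y :+ z)) refl
         c (c ^ k) (f 0) (g (suc k)) (((f ∘ suc) ⊛ g) k) ⟩
  c ^ suc k * (f ⊛ g) (suc k) ∎
  where
  open ≡-Reasoning
  open ℚ-Solver

-- The series (1 + t)^r

infix 21 [1+t]^_

[1+t]^_ : ℚ → Series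
([1+t]^ r) k = falling r k /! k

-- `falling` appends its factors at the end; here the first factor is split off instead.
falling-+1 : ∀ r k → falling (r + 1ℚ) (suc k) ≡ (r + 1ℚ) * falling r k
falling-+1 r zero = solve 1 (λ x → con 1ℚ :* (x :- con 0ℚ) := x :* con 1ℚ) refl (r + 1ℚ)
  where open ℚ-Solver
falling-+1 r (suc k) = trans
  (cong₂ (λ x y → x * (r + 1ℚ - y)) (falling-+1 r k) (fromℕ-homo-+ 1 k))
  (solve 3 (λ r x y →
    (r :+ con 1ℚ) :* x :* (r :+ con 1ℚ :- (con 1ℚ :+ y)) := (r :+ con 1ℚ) :* (x :* (r :- y)))
    refl r (falling r k) (fromℕ k))
  where open ℚ-Solver

/!-suc : ∀ q k → (fromℕ (suc k) * q) /! suc k ≡ q /! k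
/!-suc q k = begin
  s * q * e′                    ≡⟨ *-identityʳ (s * q * e′) ⟨
  -- 1 is expanded as k! · (1 / k!), so that k! joins the factor k + 1 to form (k + 1)!.
  s * q * e′ * 1ℚ               ≡⟨ cong (λ x → s * q * e′ * x) (fromℕ-inverseʳ (k !) {{k ℕ.!≢0}}) ⟨
  s * q * e′ * (f * e)          ≡⟨ solve 5 (λ s q e′ f e →
                                     s :* q :* e′ :* (f :* e) := s :* f :* e′ :* (q :* e))
                                     refl s q e′ f e ⟩
  s * f * e′ * (q * e)          ≡⟨ cong (λ x → x * e′ * (q * e)) (fromℕ-homo-* (suc k) (k !)) ⟨
  fromℕ (suc k !) * e′ * (q * e)  ≡⟨ cong (_* (q * e)) (fromℕ-inverseʳ (suc k !) {{suc k ℕ.!≢0}}) ⟩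
  1ℚ * (q * e)                  ≡⟨ *-identityˡ (q * e) ⟩
  q * e                         ∎
  where
  open ≡-Reasoning
  open ℚ-Solver
  s f e e′ : ℚ
  s  = fromℕ (suc k)
  f  = fromℕ (k !)
  e  = (+ 1 / k !) {{k ℕ.!≢0}}
  e′ = (+ 1 / suc k !) {{suc k ℕ.!≢0}}

-- In degree k + 1, writing the leading factor of (r + 1)(r)_k as r + 1 = (r - k) + (k + 1) produces
-- (r)_{k+1} and (k + 1)(r)_k; over (k + 1)! the latter is (r)_k / k!.
[1+t]^-pascal : ∀ r → [1+t]^ (r + 1ℚ) ≗ [1+t]^ r ⊕ (t ⊛ [1+t]^ r)
[1+t]^-pascal r zero = refl
[1+t]^-pascal r (suc k) = begin
  falling (r + 1ℚ) (suc k) /! suc k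
    ≡⟨ cong (_/! suc k) (falling-+1 r k) ⟩
  ((r + 1ℚ) * falling r k) /! suc k
    ≡⟨ solve 4 (λ r x y e →
         (r :+ con 1ℚ) :* x :* e :=
         x :* (r :- y) :* e :+
         (con 1ℚ :+ y) :* x :* e) refl
         r (falling r k) (fromℕ k) ((+ 1 / suc k !) {{suc k ℕ.!≢0}}) ⟩
  falling r (suc k) /! suc k + ((1ℚ + fromℕ k) * falling r k) /! suc k
    ≡⟨ cong (λ x → falling r (suc k) /! suc k + (x * falling r k) /! suc k) (fromℕ-homo-+ 1 k) ⟨
  falling r (suc k) /! suc k + (fromℕ (suc k) * falling r k) /! suc k
    ≡⟨ cong (λ x → falling r (suc k) /! suc k + x) (trans (/!-suc (falling r k) k)
         (sym (t-⊛-suc ([1+t]^ r) k))) ⟩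
  falling r (suc k) /! suc k + (t ⊛ [1+t]^ r) (suc k) ∎
  where
  open ≡-Reasoning
  open ℚ-Solver

[1+t]^-suc : ∀ r → [1+t]^ (r + 1ℚ) ≗ [1+t]^ r ⊛ (one ⊕ t)
[1+t]^-suc r = 𝕊.trans ([1+t]^-pascal r)
  (solve 2 (λ x t → x :+ t :* x := x :* (con 1 :+ t)) (λ _ → refl) ([1+t]^ r) t)
  where open 𝕊-Solver

[1+t]^0 : [1+t]^ 0ℚ ≗ one
[1+t]^0 zero    = refl
[1+t]^0 (suc k) = trans (cong (_/! suc k) (falling-0 k)) (*-zeroˡ ((+ 1 / suc k !) {{suc k ℕ.!≢0}}))
  where
  falling-0 : ∀ k → falling 0ℚ (suc k) ≡ 0ℚ
  falling-0 zero    = refl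
  falling-0 (suc k) = trans (cong (λ x → x * (0ℚ - fromℕ (suc k))) (falling-0 k))
    (*-zeroˡ (0ℚ - fromℕ (suc k)))

[1+t]^-cong : ∀ {r s} → r ≡ s → [1+t]^ r ≗ [1+t]^ s
[1+t]^-cong refl _ = refl

-- Induction on n, one factor 1 + t at a time. The base exponent r ranges over ℚ so that it can be
-- the negative number - b m.
[1+t]^-+ : ∀ r n → [1+t]^ (r + fromℕ n) ≗ [1+t]^ r ⊛ [1+t]^ (fromℕ n)
[1+t]^-+ r zero = 𝕊.trans ([1+t]^-cong (+-identityʳ r))
  (𝕊.trans (𝕊.sym (𝕊.*-identityʳ ([1+t]^ r))) (𝕊.*-congˡ {[1+t]^ r} (𝕊.sym [1+t]^0)))
[1+t]^-+ r (suc n) = begin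
  [1+t]^ (r + fromℕ (suc n))                  ≈⟨ [1+t]^-cong r+suc≡ ⟩
  [1+t]^ (r + fromℕ n + 1ℚ)                   ≈⟨ [1+t]^-suc (r + fromℕ n) ⟩
  [1+t]^ (r + fromℕ n) ⊛ (one ⊕ t)            ≈⟨ 𝕊.*-congʳ {one ⊕ t} ([1+t]^-+ r n) ⟩
  ([1+t]^ r ⊛ [1+t]^ (fromℕ n)) ⊛ (one ⊕ t)   ≈⟨ 𝕊.*-assoc ([1+t]^ r) ([1+t]^ (fromℕ n)) (one ⊕ t) ⟩
  [1+t]^ r ⊛ ([1+t]^ (fromℕ n) ⊛ (one ⊕ t))   ≈⟨ 𝕊.*-congˡ {[1+t]^ r} ([1+t]^-suc (fromℕ n)) ⟨
  [1+t]^ r ⊛ [1+t]^ (fromℕ n + 1ℚ)            ≈⟨ 𝕊.*-congˡ {[1+t]^ r} ([1+t]^-cong suc≡) ⟨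
  [1+t]^ r ⊛ [1+t]^ (fromℕ (suc n))           ∎
  where
  open SetoidReasoning 𝕊.setoid
  open ℚ-Solver
  suc≡ : fromℕ (suc n) ≡ fromℕ n + 1ℚ
  suc≡ = trans (cong fromℕ (ℕ.+-comm 1 n)) (fromℕ-homo-+ n 1)
  r+suc≡ : r + fromℕ (suc n) ≡ r + fromℕ n + 1ℚ
  r+suc≡ = trans (cong (λ x → r + x) suc≡)
    (solve 2 (λ r x → r :+ (x :+ con 1ℚ) :=
       r :+ x :+ con 1ℚ) refl r (fromℕ n))

[1+t]^1 : [1+t]^ 1ℚ ≗ one ⊕ t
[1+t]^1 = begin
  [1+t]^ 1ℚ             ≈⟨ [1+t]^-suc 0ℚ ⟩
  [1+t]^ 0ℚ ⊛ (one ⊕ t) ≈⟨ 𝕊.*-congʳ {one ⊕ t} [1+t]^0 ⟩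
  one ⊛ (one ⊕ t)       ≈⟨ 𝕊.*-identityˡ (one ⊕ t) ⟩
  one ⊕ t               ∎
  where open SetoidReasoning 𝕊.setoid

-- The series (1 + t)^m - 1, with the subtraction done in each coefficient.
power-1 : ℕ → Series
power-1 m k = ([1+t]^ (fromℕ m)) k - one k

power-1⊕one : ∀ m → power-1 m ⊕ one ≗ [1+t]^ (fromℕ m)
power-1⊕one m k = solve 2 (λ x y → x :- y :+ y := x) refl (([1+t]^ (fromℕ m)) k) (one k)
  where open ℚ-Solver

-- Generating functions of β̃ and σ̃

β̂ : (m : ℕ) .{{_ : ℕ.NonZero m}} → Series
β̂ m k = β̃ k m /! k

σ̂ : (l c : ℕ) → Series
σ̂ l c k = σ̃ k l c /! k

-- Substituting m t for t in the generating function at λ = 1/m turns (1 + t/m)^m into (1 + t)^m and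
-- β_k(1/m) into β̃_k(m), while the right side t becomes m t.
β̂-generating : ∀ m .{{_ : ℕ.NonZero m}} → power-1 m ⊛ β̂ m ≗ constant (fromℕ m) ⊛ t
β̂-generating m = begin
  power-1 m ⊛ β̂ m               ≈⟨ ⊛-cong binomial≗ bernoulli≗ ⟩
  substitute c g ⊛ substitute c h  ≈⟨ substitute-⊛ c g h ⟩
  substitute c (g ⊛ h)             ≈⟨ (λ k → cong (c ^ k *_) (degenerateBernoulli-generating l k)) ⟩
  substitute c t                   ≈⟨ substitute-t ⟩
  c · t                            ≈⟨ constant-⊛ c t ⟨
  constant c ⊛ t                   ∎
  where
  open SetoidReasoning 𝕊.setoid
  open ℚ-Solver
  c l : ℚ
  c = fromℕ m
  l = + 1 / m
  instance
    l≢0 : NonZero l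
    l≢0 = pos⇒nonZero l {{normalize-pos 1 m}}
  g h : Series
  g k = binomialSeries l k - one k
  h k = degenerateBernoulli k l /! k
  substitute-t : substitute c t ≗ c · t
  substitute-t zero          = sym (*-zeroʳ c)
  substitute-t (suc zero)    = cong (_* 1ℚ) (*-identityʳ c)
  substitute-t (suc (suc k)) = trans (*-zeroʳ (c ^ suc (suc k))) (sym (*-zeroʳ c))
  substitute-one : substitute c one ≗ one
  substitute-one zero    = refl
  substitute-one (suc k) = *-zeroʳ (c ^ suc k)
  c^k*l^k≡1 : ∀ k → c ^ k * l ^ k ≡ 1ℚ
  c^k*l^k≡1 zero    = refl
  c^k*l^k≡1 (suc k) = trans
    (solve 4 (λ c l x y → c :* x :* (l :* y) := c :* l :* (x :* y)) refl c l (c ^ k) (l ^ k))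
    (cong₂ _*_ (fromℕ-inverseʳ m) (c^k*l^k≡1 k))
  bernoulli≗ : β̂ m ≗ substitute c h
  bernoulli≗ k = *-assoc (c ^ k) (degenerateBernoulli k l) ((+ 1 / k !) {{k ℕ.!≢0}})
  binomial≗ : power-1 m ≗ substitute c g
  binomial≗ k = sym (trans
    -- Since 1/l = m, the falling factorials in `binomialSeries l` are (m)_k; the factor c^k then
    -- cancels l^k.
    (cong (λ x → c ^ k * (falling x k * l ^ k /! k - one k)) (1/-unique c l (fromℕ-inverseʳ m)))
    (trans
      (solve 5 (λ x y f e o → x :* (f :* y :* e :- o) := x :* y :* (f :* e) :- x :* o) refl
        (c ^ k) (l ^ k) (falling c k) ((+ 1 / k !) {{k ℕ.!≢0}}) (one k))
      (cong₂ _-_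
        (trans (cong (_* (falling c k /! k)) (c^k*l^k≡1 k)) (*-identityˡ (falling c k /! k)))
        (substitute-one k))))

-- Geometric sums.

sumSeries : ℕ → (ℕ → Series) → Series
sumSeries c x k = sum {c} (λ i → x (toℕ i) k)

-- Telescoping, since x_i v = x_{i+1} - x_i. Giving x by its recurrence rather than as explicit
-- powers lets the induction pass to `x ∘ suc` when the first term is split off.
geometric-sum : ∀ (x : ℕ → Series) v → (∀ i → x (suc i) ≗ x i ⊛ (v ⊕ one)) →
  ∀ c → (sumSeries c x ⊛ v) ⊕ x 0 ≗ x c
geometric-sum x v step zero    = 𝕊.trans (𝕊.+-congʳ {x 0} (𝕊.zeroˡ v)) (𝕊.+-identityˡ (x 0))
geometric-sum x v step (suc c) = begin
  ((x 0 ⊕ s) ⊛ v) ⊕ x 0          ≈⟨ solve 3 (λ x s v →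
                                      (x :+ s) :* v :+ x := s :* v :+ x :* (v :+ con 1))
                                      (λ _ → refl) (x 0) s v ⟩
  (s ⊛ v) ⊕ (x 0 ⊛ (v ⊕ one))    ≈⟨ 𝕊.+-congˡ {s ⊛ v} (step 0) ⟨
  (s ⊛ v) ⊕ x 1                  ≈⟨ geometric-sum (x ∘ suc) v (step ∘ suc) c ⟩
  x (suc c)                      ∎
  where
  open SetoidReasoning 𝕊.setoid
  open 𝕊-Solver
  s : Series
  s = sumSeries c (x ∘ suc)

-- `σ̂ n (a ∸ 1)` is the geometric sum of (1 + t)^(n i) over i < a: the upper limit in `σ̃` is
-- included, so for a > 0 the bound `a ∸ 1` gives exactly a terms.
σ̂-geometric : ∀ n a → 0 < a → (σ̂ n (a ∸ 1) ⊛ power-1 n) ⊕ one ≗ [1+t]^ (fromℕ (n ℕ.* a))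
σ̂-geometric n (suc c) _ = begin
  (σ̂ n c ⊛ v) ⊕ one               ≈⟨ 𝕊.+-cong (⊛-cong {g = v} σ̂≗ (λ _ → refl)) one≗ ⟩
  (sumSeries (suc c) x ⊛ v) ⊕ x 0  ≈⟨ geometric-sum x v step (suc c) ⟩
  x (suc c)                        ∎
  where
  open SetoidReasoning 𝕊.setoid
  x : ℕ → Series
  x i = [1+t]^ (fromℕ (n ℕ.* i))
  v : Series
  v = power-1 n
  σ̂≗ : σ̂ n c ≗ sumSeries (suc c) x
  σ̂≗ k = *-distribʳ-sum {suc c} ((+ 1 / k !) {{k ℕ.!≢0}})
    (λ i → falling (fromℕ (n ℕ.* toℕ i)) k)
  one≗ : one ≗ x 0
  one≗ = 𝕊.trans (𝕊.sym [1+t]^0) ([1+t]^-cong (cong fromℕ (sym (ℕ.*-zeroʳ n))))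
  step : ∀ i → x (suc i) ≗ x i ⊛ (v ⊕ one)
  step i = begin
    [1+t]^ (fromℕ (n ℕ.* suc i))           ≈⟨ [1+t]^-cong (trans
                                                (cong fromℕ (trans (ℕ.*-suc n i) (ℕ.+-comm n (n ℕ.* i))))
                                                (fromℕ-homo-+ (n ℕ.* i) n)) ⟩
    [1+t]^ (fromℕ (n ℕ.* i) + fromℕ n)     ≈⟨ [1+t]^-+ (fromℕ (n ℕ.* i)) n ⟩
    x i ⊛ [1+t]^ (fromℕ n)                 ≈⟨ 𝕊.*-congˡ {x i} (power-1⊕one n) ⟨
    x i ⊛ (v ⊕ one)                        ∎

-- The convolution identity attached to a positive solution of a n - b m = 1.

module _ (m n : ℕ) .{{_ : ℕ.NonZero m}} .{{_ : ℕ.NonZero n}}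
         (a b : ℕ) (0<a : 0 < a) (0<b : 0 < b)
         (an-bm≡1 : + a ℤ.* + n ℤ.- + b ℤ.* + m ≡ + 1) where

  private
    p s s′ v v′ : Series
    p  = [1+t]^ (fromℤ (ℤ.- (+ (b ℕ.* m))))
    s  = σ̂ n (a ∸ 1)
    s′ = σ̂ m (b ∸ 1)
    v  = power-1 n
    v′ = power-1 m

  -- Adding p to both sides completes each geometric sum to a power of 1 + t. The left side becomes
  -- (1 + t)^(- b m + n a) = 1 + t, the right side (1 + t)^(- b m + m b) + t = 1 + t.
  shifted-geometric-difference : p ⊛ (s ⊛ v) ≗ (p ⊛ (s′ ⊛ v′)) ⊕ t
  shifted-geometric-difference k = Group.∙-cancelʳ +-0-group (p k) _ _ (eq k)
    where
    open SetoidReasoning 𝕊.setoid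
    open 𝕊-Solver
    -bm : ℤ
    -bm = ℤ.- (+ (b ℕ.* m))
    -bm+na≡1 : fromℤ -bm + fromℕ (n ℕ.* a) ≡ 1ℚ
    -bm+na≡1 = trans (sym (fromℤ-homo-+ -bm (+ (n ℕ.* a)))) (cong fromℤ (trans
      (ℤ.+-comm -bm (+ (n ℕ.* a)))
      (trans (cong₂ (λ i j → i ℤ.- j)
        (trans (cong +_ (ℕ.*-comm n a)) (ℤ.pos-* a n)) (ℤ.pos-* b m)) an-bm≡1)))
    -bm+mb≡0 : fromℤ -bm + fromℕ (m ℕ.* b) ≡ 0ℚ
    -bm+mb≡0 = trans (sym (fromℤ-homo-+ -bm (+ (m ℕ.* b)))) (cong fromℤ
      (trans (cong (λ i → -bm ℤ.+ + i) (ℕ.*-comm m b)) (ℤ.+-inverseˡ (+ (b ℕ.* m)))))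
    eq : (p ⊛ (s ⊛ v)) ⊕ p ≗ ((p ⊛ (s′ ⊛ v′)) ⊕ t) ⊕ p
    eq = begin
      (p ⊛ (s ⊛ v)) ⊕ p
        ≈⟨ solve 3 (λ p s v → p :* (s :* v) :+ p := p :* (s :* v :+ con 1)) (λ _ → refl) p s v ⟩
      p ⊛ ((s ⊛ v) ⊕ one)
        ≈⟨ 𝕊.*-congˡ {p} (σ̂-geometric n a 0<a) ⟩
      p ⊛ [1+t]^ (fromℕ (n ℕ.* a))
        ≈⟨ [1+t]^-+ (fromℤ -bm) (n ℕ.* a) ⟨
      [1+t]^ (fromℤ -bm + fromℕ (n ℕ.* a))
        ≈⟨ [1+t]^-cong -bm+na≡1 ⟩
      [1+t]^ 1ℚ
        ≈⟨ [1+t]^1 ⟩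
      one ⊕ t
        ≈⟨ 𝕊.+-congʳ {t} [1+t]^0 ⟨
      [1+t]^ 0ℚ ⊕ t
        ≈⟨ 𝕊.+-congʳ {t} ([1+t]^-cong -bm+mb≡0) ⟨
      [1+t]^ (fromℤ -bm + fromℕ (m ℕ.* b)) ⊕ t
        ≈⟨ 𝕊.+-congʳ {t} ([1+t]^-+ (fromℤ -bm) (m ℕ.* b)) ⟩
      (p ⊛ [1+t]^ (fromℕ (m ℕ.* b))) ⊕ t
        ≈⟨ 𝕊.+-congʳ {t} (𝕊.*-congˡ {p} (σ̂-geometric m b 0<b)) ⟨
      (p ⊛ ((s′ ⊛ v′) ⊕ one)) ⊕ t
        ≈⟨ solve 4 (λ p s v t → p :* (s :* v :+ con 1) :+ t := p :* (s :* v) :+ t :+ p)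
             (λ _ → refl) p s′ v′ t ⟩
      ((p ⊛ (s′ ⊛ v′)) ⊕ t) ⊕ p ∎

  -- After multiplication by t, the factor n t is replaced by `v ⊛ β̂ n`, which supplies the v
  -- required by the geometric difference. The resulting `v′ ⊛ β̂ m` is m t, so t is a common factor
  -- again and cancels.
  β̂-reciprocity : constant (fromℕ n) ⊛ ((p ⊛ s) ⊛ β̂ m) ≗
                  (constant (fromℕ m) ⊛ ((p ⊛ s′) ⊛ β̂ n)) ⊕ (β̂ m ⊛ β̂ n)
  β̂-reciprocity = t-cancel (begin
    t ⊛ (cₙ ⊛ ((p ⊛ s) ⊛ β̂ m))
      ≈⟨ solve 3 (λ t c x → t :* (c :* x) := c :* t :* x) (λ _ → refl) t cₙ ((p ⊛ s) ⊛ β̂ m) ⟩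
    (cₙ ⊛ t) ⊛ ((p ⊛ s) ⊛ β̂ m)
      ≈⟨ 𝕊.*-congʳ {(p ⊛ s) ⊛ β̂ m} (β̂-generating n) ⟨
    (v ⊛ β̂ n) ⊛ ((p ⊛ s) ⊛ β̂ m)
      ≈⟨ solve 5 (λ v y p s x → v :* y :* (p :* s :* x) := p :* (s :* v) :* (x :* y))
           (λ _ → refl) v (β̂ n) p s (β̂ m) ⟩
    (p ⊛ (s ⊛ v)) ⊛ (β̂ m ⊛ β̂ n)
      ≈⟨ 𝕊.*-congʳ {β̂ m ⊛ β̂ n} shifted-geometric-difference ⟩
    ((p ⊛ (s′ ⊛ v′)) ⊕ t) ⊛ (β̂ m ⊛ β̂ n)
      ≈⟨ solve 6 (λ p s v t x y →
           (p :* (s :* v) :+ t) :* (x :* y) := v :* x :* (p :* s :* y) :+ t :* (x :* y))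
           (λ _ → refl) p s′ v′ t (β̂ m) (β̂ n) ⟩
    ((v′ ⊛ β̂ m) ⊛ ((p ⊛ s′) ⊛ β̂ n)) ⊕ (t ⊛ (β̂ m ⊛ β̂ n))
      ≈⟨ 𝕊.+-congʳ {t ⊛ (β̂ m ⊛ β̂ n)} (𝕊.*-congʳ {(p ⊛ s′) ⊛ β̂ n} (β̂-generating m)) ⟩
    ((cₘ ⊛ t) ⊛ ((p ⊛ s′) ⊛ β̂ n)) ⊕ (t ⊛ (β̂ m ⊛ β̂ n))
      ≈⟨ solve 4 (λ c t x y → c :* t :* x :+ t :* y := t :* (c :* x :+ y))
           (λ _ → refl) cₘ t ((p ⊛ s′) ⊛ β̂ n) (β̂ m ⊛ β̂ n) ⟩
    t ⊛ ((cₘ ⊛ ((p ⊛ s′) ⊛ β̂ n)) ⊕ (β̂ m ⊛ β̂ n)) ∎)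
    where
    open SetoidReasoning 𝕊.setoid
    open 𝕊-Solver
    cₘ cₙ : Series
    cₘ = constant (fromℕ m)
    cₙ = constant (fromℕ n)

  β̃-convolution : ∀ k →
    (∑[ k₁ + k₂ ≡ k ] (β̃ k₁ m /! k₁) * (β̃ k₂ n /! k₂))
    ≡
    fromℕ n * (∑[ k₁ + k₂ ≡ k ] ∑[ s₁ + s₂ ≡ k₁ ] p s₁ * s s₂ * β̂ m k₂)
    -
    fromℕ m * (∑[ k₁ + k₂ ≡ k ] ∑[ s₁ + s₂ ≡ k₁ ] p s₁ * s′ s₂ * β̂ n k₂)
  β̃-convolution k = begin
    -- The convolution on the left of the claim unfolds to the coefficient z of `β̂ m ⊛ β̂ n`; the
    -- reciprocity then becomes a difference in ℚ.
    z                                        ≡⟨ solve 2 (λ z y → z := y :+ z :- y) refl z (fromℕ m * y) ⟩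
    fromℕ m * y + z - fromℕ m * y            ≡⟨ cong (_- fromℕ m * y) nx≡my+z ⟨
    fromℕ n * x - fromℕ m * y
      ≡⟨ cong₂ (λ x y → fromℕ n * x - fromℕ m * y) (double-sum p s (β̂ m)) (double-sum p s′ (β̂ n)) ⟩
    fromℕ n * (∑[ k₁ + k₂ ≡ k ] ∑[ s₁ + s₂ ≡ k₁ ] p s₁ * s s₂ * β̂ m k₂)
    -
    fromℕ m * (∑[ k₁ + k₂ ≡ k ] ∑[ s₁ + s₂ ≡ k₁ ] p s₁ * s′ s₂ * β̂ n k₂) ∎
    where
    open ≡-Reasoning
    open ℚ-Solver
    x y z : ℚ
    x = ((p ⊛ s) ⊛ β̂ m) k
    y = ((p ⊛ s′) ⊛ β̂ n) k
    z = (β̂ m ⊛ β̂ n) k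
    nx≡my+z : fromℕ n * x ≡ fromℕ m * y + z
    nx≡my+z = trans (sym (constant-⊛ (fromℕ n) ((p ⊛ s) ⊛ β̂ m) k))
      (trans (β̂-reciprocity k) (cong (_+ z) (constant-⊛ (fromℕ m) ((p ⊛ s′) ⊛ β̂ n) k)))
    -- The Cauchy product multiplies each inner sum by `h k₂` as a whole, whereas the formula
    -- carries this factor inside the inner sum.
    double-sum : ∀ f g h → ((f ⊛ g) ⊛ h) k ≡ ∑[ k₁ + k₂ ≡ k ] ∑[ i + j ≡ k₁ ] f i * g j * h k₂
    double-sum f g h = sum-cong-≗ {suc k} λ i →
      *-distribʳ-sum {suc (toℕ i)} (h (k ∸ toℕ i)) (λ j → f (toℕ j) * g (toℕ i ∸ toℕ j))

theorem7p3 : (m n : ℕ) .{{_ : ℕ.NonZero m}} .{{_ : ℕ.NonZero n}} →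
    2 ≤ m → 3 ≤ n → Coprime m n →
    (a b α β : ℕ) →
    IsSmallestSolution n m a b →
    IsSmallestSolution m n α β →
    (k : ℕ) →
    (a > β →
    (∑[ k₁ + k₂ ≡ k ] (β̃ k₁ m /! k₁) * (β̃ k₂ n /! k₂))
    ≡
    fromℕ n * (∑[ k₁ + k₂ ≡ k ] ∑[ s₁ + s₂ ≡ k₁ ]
    (falling (fromℤ (ℤ.- (+ (b ℕ.* m)))) s₁ /! s₁) * (σ̃ s₂ n (a ∸ 1) /! s₂) * (β̃ k₂ m /! k₂))
    -
    fromℕ m * (∑[ k₁ + k₂ ≡ k ] ∑[ s₁ + s₂ ≡ k₁ ]
    (falling (fromℤ (ℤ.- (+ (b ℕ.* m)))) s₁ /! s₁) * (σ̃ s₂ m (b ∸ 1) /! s₂) * (β̃ k₂ n /! k₂)))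
    ×
    (a < β →
    (∑[ k₁ + k₂ ≡ k ] (β̃ k₁ m /! k₁) * (β̃ k₂ n /! k₂))
    ≡
    fromℕ m * (∑[ k₁ + k₂ ≡ k ] ∑[ s₁ + s₂ ≡ k₁ ]
    (falling (fromℤ (ℤ.- (+ (β ℕ.* n)))) s₁ /! s₁) * (σ̃ s₂ m (α ∸ 1) /! s₂) * (β̃ k₂ n /! k₂))
    -
    fromℕ n * (∑[ k₁ + k₂ ≡ k ] ∑[ s₁ + s₂ ≡ k₁ ]
    (falling (fromℤ (ℤ.- (+ (β ℕ.* n)))) s₁ /! s₁) * (σ̃ s₂ n (β ∸ 1) /! s₂) * (β̃ k₂ m /! k₂)))
theorem7p3 m n _ _ _ a b α β ((0<a , 0<b , an-bm≡1) , _) ((0<α , 0<β , αm-βn≡1) , _) k =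
  (λ _ → β̃-convolution m n a b 0<a 0<b an-bm≡1 k) ,
  -- Exchanging m and n, with (α, β) as the solution of α m - β n = 1, gives the expansion of
  -- `β̂ n ⊛ β̂ m`; commutativity restores the order of the left side.
  (λ _ → trans (⊛-comm (β̂ m) (β̂ n) k) (β̃-convolution n m α β 0<α 0<β αm-βn≡1 k))
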